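{- Let $\mathbf{C}$ be a small category with countably many arrows, $O$ a set of observations and $T$ an inference system. Let $\mathbf{Coalg}_{\mathbf{H}^I}$ be the full subcategory of $\mathbf{Coalg}_{\mathbf{H}}$ containing the $\mathbf{H}$-coalgebras $\alpha:\mathbb{X}\to\mathbf{H}(\mathbb{X})$ that factor as $\alpha=\alpha';\iota_{\mathbb{X}}$ for some $\Gamma(\mathbf{C})$-homomorphism $\alpha':\mathbb{X}\to\mathbf{S}_T(\mathbb{X})$, where $\iota_{\mathbb{X}}:\mathbf{S}_T(\mathbb{X})\to\mathbf{H}(\mathbb{X})$ is the inclusion. Then the class of objects $|\mathbf{Coalg}_{\mathbf{H}^I}|$ is a covariety of $\mathbf{Coalg}_{\mathbf{H}}$, i.e. it is closed under (1) subcoalgebras, (2) homomorphic images, and (3) sums.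
   Context: Composition is written in diagrammatic order: $f;g$ means first $f$, then $g$. $|\mathbf{C}|$ is the set of objects and $\|\mathbf{C}\|$ the set of arrows of $\mathbf{C}$. A $\Gamma(\mathbf{C})$-algebra $\mathbb{X}$ is a family of sets $X=(X_i)_{i\in|\mathbf{C}|}$ with a function $c_{\mathbb{X}}:X_i\to X_j$ for every $c\in\mathbf{C}[i,j]$ such that $(id_i)_{\mathbb{X}}=id_{X_i}$ and $(d;e)_{\mathbb{X}}(x)=e_{\mathbb{X}}(d_{\mathbb{X}}(x))$ (i.e. a functor $\mathbf{C}\to\mathbf{Set}$). Homomorphisms are natural transformations; the category is $\mathbf{Alg}_{\Gamma(\mathbf{C})}$. $\int X=\sum_{i}X_i$. $\mathbf{G}(X)_i$ is the set of (at most) countable subsets of $\sum_{j\in|\mathbf{C}|}\mathbf{C}[i,j]\times O\times\int X$. The endofunctor $\mathbf{H}$ of $\mathbf{Alg}_{\Gamma(\mathbf{C})}$ maps $\mathbb{X}$ to the algebra with carrier $(\mathbf{G}(X)_i)_i$ and, for $d\in\mathbf{C}[i,k]$, $d_{\mathbf{H}(\mathbb{X})}(A)=\{(c_2,o,x)\mid (c_1,o,x)\in A,\ c_1=d;c_2\}$; on arrows $\mathbf{H}(h)(A)=\{(c,o,h(x))\mid(c,o,x)\in A\}$. An $\mathbf{H}$-coalgebra is $\langle\mathbb{X},\alpha:\mathbb{X}\to\mathbf{H}(\mathbb{X})\rangle$; morphisms $\langle\mathbb{X},\alpha\rangle\to\langle\mathbb{Y},\beta\rangle$ are homomorphisms $f$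 with $\alpha;\mathbf{H}(f)=f;\beta$. An inference system $T$ is a set of rules $c\xrightarrow[o']{o}d$ with $c\in\mathbf{C}[i,i']$, $d\in\mathbf{C}[j,j']$, $o,o'\in O$. $\Phi(T)$ is the closure of $T$ together with all identity rules $id_i\xrightarrow[o]{o}id_j$ ($i,j\in|\mathbf{C}|$, $o\in O$) under: $c\xrightarrow[o']{o}c'$ and $d\xrightarrow[o'']{o'}d'$ give $c;d\xrightarrow[o'']{o}c';d'$ whenever $c;d$ and $c';d'$ are defined. For $d\in\mathbf{C}[i,k]$, $c_1$ of source $i$ and $c_2$ of source $k$, write $(c_1,o_1,q_1)\vdash^{d}_{T,\mathbb{X}}(c_2,o_2,q_2)$ iff there are $e,e'\in\|\mathbf{C}\|$ with $c_1;e=d;c_2$, $e\xrightarrow[o_2]{o_1}e'\in\Phi(T)$ and $e'_{\mathbb{X}}(q_1)=q_2$. Write $\vdash_{T,\mathbb{X}}$ for $\vdash^{id}_{T,\mathbb{X}}$. $A\in\mathbf{G}(X)_i$ is saturated if closed under $\vdash_{T,\mathbb{X}}$. The endofunctor $\mathbf{S}_T$ maps $\mathbb{X}$ to the algebra whose carrier of sort $i$ is the set of saturated sets in $\mathbf{G}(X)_i$, with $d_{\mathbf{S}_T(\mathbb{X})}(A)=\{t_2\mid \exists t_1\in A,\ t_1\vdash^{d}_{T,\mathbb{X}}t_2\}$; on arrows it acts as $\mathbf{H}$. $\langle\mathbb{X},\alpha\rangle$ is a subcoalgebra of $\langle\mathbb{Y},\beta\rangle$ if there is a coalgebra morphism between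 them all of whose components (one per sort) are injective. For a coalgebra morphism $h:\langle\mathbb{X},\alpha\rangle\to\langle\mathbb{Y},\beta\rangle$, factor $h=e;m$ in $\mathbf{Alg}_{\Gamma(\mathbf{C})}$ with $e:\mathbb{X}\to\mathbb{I}$ componentwise surjective and $m:\mathbb{I}\to\mathbb{Y}$ componentwise injective; there is a unique $\gamma:\mathbb{I}\to\mathbf{H}(\mathbb{I})$ making $e$ and $m$ coalgebra morphisms, and $\langle\mathbb{I},\gamma\rangle$ is the homomorphic image of $\langle\mathbb{X},\alpha\rangle$ through $h$. Sums are coproducts in $\mathbf{Coalg}_{\mathbf{H}}$. -}

module Defs where

open import Data.Nat using (ℕ; zero; suc; _*_)
open import Data.Nat.Properties using (even≢odd; suc-injective; *-cancelˡ-≡)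
open import Data.Product using (Σ; ∃; _×_; _,_; proj₁; proj₂)
open import Data.Product.Relation.Binary.Pointwise.NonDependent using (_×ₛ_)
open import Function.Bundles using (Func; _↣_; Injection)
open import Function.Construct.Composition using (function)
open import Function.Definitions using (Injective; Surjective)
open import Level using (Level; _⊔_) renaming (suc to lsuc)
open import Relation.Binary.Bundles using (Setoid)
open import Relation.Binary.Definitions using (_Respects_)
open import Relation.Binary.PropositionalEquality
  using (_≡_; refl; sym; trans; cong; cong₂) renaming (setoid to ≡-setoid)
open import Relation.Nullary using (contradiction)
open import Relation.Unary using (Pred; _∈_; _≐_)
open import Relation.Unary.Properties using (≐-refl; ≐-sym; ≐-trans)

-- Conventions.  `Set ℓ` is the universe of (small) sets.  Objects, arrows and
-- observations are types compared by _≡_.  Carriers of algebras are setoids,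
-- because they have to include sets of subsets (compared extensionally) and
-- images of maps.

record Category (ℓ : Level) : Set (lsuc ℓ) where
  infixr 9 _⨾_
  field
    Obj   : Set ℓ
    Hom   : Obj → Obj → Set ℓ
    id    : ∀ {i} → Hom i i
    _⨾_   : ∀ {i j k} → Hom i j → Hom j k → Hom i k
    idˡ   : ∀ {i j} (c : Hom i j) → id ⨾ c ≡ c
    idʳ   : ∀ {i j} (c : Hom i j) → c ⨾ id ≡ c
    assoc : ∀ {i j k l} (c : Hom i j) (d : Hom j k) (e : Hom k l) →
            (c ⨾ d) ⨾ e ≡ c ⨾ (d ⨾ e)

  Arrow : Set ℓ
  Arrow = ∃ λ i → ∃ λ j → Hom i j

-- "At most countable": the subset P is the image of a partial function ℕ ⇀ S.
-- That function sends code p to the element x with p : P x.  An element may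
-- have several codes, so code need not respect equality.
record Countable {a e p} (S : Setoid a e) (P : Pred (Setoid.Carrier S) p) :
                 Set (a ⊔ e ⊔ p) where
  open Setoid S using (_≈_)
  field
    code           : ∀ {x} → P x → ℕ
    code-injective : ∀ {x y} (p : P x) (q : P y) → code p ≡ code q → x ≈ y

pair : ℕ → ℕ → ℕ
pair zero    n = suc (2 * n)
pair (suc m) n = 2 * pair m n

pair-injective : ∀ m n m′ n′ → pair m n ≡ pair m′ n′ → m ≡ m′ × n ≡ n′
pair-injective zero    n zero     n′ eq = refl , *-cancelˡ-≡ n n′ 2 (suc-injective eq)
pair-injective zero    n (suc m′) n′ eq = contradiction (sym eq) (even≢odd (pair m′ n′) n)
pair-injective (suc m) n zero     n′ eq = contradiction eq (even≢odd (pair m n) n′)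
pair-injective (suc m) n (suc m′) n′ eq
  with refl , n≡n′ ← pair-injective m n m′ n′ (*-cancelˡ-≡ (pair m n) (pair m′ n′) 2 eq)
  = refl , n≡n′

module Algebras {ℓ} (C : Category ℓ) where
  open Category C

  record Algebra (a e : Level) : Set (ℓ ⊔ lsuc (a ⊔ e)) where
    field
      carrier : Obj → Setoid a e

    ⟨_⟩ : Obj → Set a
    ⟨ i ⟩ = Setoid.Carrier (carrier i)

    Eq : ∀ i → ⟨ i ⟩ → ⟨ i ⟩ → Set e
    Eq i = Setoid._≈_ (carrier i)

    field
      action : ∀ {i j} → Hom i j → Func (carrier i) (carrier j)

    act : ∀ {i j} → Hom i j → ⟨ i ⟩ → ⟨ j ⟩
    act c = Func.to (action c)

    field
      act-id : ∀ {i} (x : ⟨ i ⟩) → Eq i (act id x) x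
      act-⨾  : ∀ {i j k} (d : Hom i j) (e : Hom j k) (x : ⟨ i ⟩) →
               Eq k (act (d ⨾ e) x) (act e (act d x))

  record Homomorphism {a e a′ e′} (X : Algebra a e) (Y : Algebra a′ e′) :
                      Set (ℓ ⊔ a ⊔ e ⊔ a′ ⊔ e′) where
    private
      module X = Algebra X
      module Y = Algebra Y
    field
      fun : ∀ i → Func (X.carrier i) (Y.carrier i)

    to : ∀ {i} → X.⟨ i ⟩ → Y.⟨ i ⟩
    to {i} = Func.to (fun i)

    field
      natural : ∀ {i j} (c : Hom i j) (x : X.⟨ i ⟩) →
                Y.Eq j (to (X.act c x)) (Y.act c (to x))

  infix 4 _≋_
  _≋_ : ∀ {a e a′ e′} {X : Algebra a e} {Y : Algebra a′ e′} →
        Homomorphism X Y → Homomorphism X Y → Set (ℓ ⊔ a ⊔ e′)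
  _≋_ {X = X} {Y} f g =
    ∀ i (x : Algebra.⟨_⟩ X i) → Algebra.Eq Y i (Homomorphism.to f x) (Homomorphism.to g x)

  infixr 9 _⨟_
  _⨟_ : ∀ {a e a′ e′ a″ e″} {X : Algebra a e} {Y : Algebra a′ e′} {Z : Algebra a″ e″} →
        Homomorphism X Y → Homomorphism Y Z → Homomorphism X Z
  _⨟_ {Z = Z} f g = record
    { fun     = λ i → function (f.fun i) (g.fun i)
    ; natural = λ {i} {j} c x →
        Setoid.trans (Algebra.carrier Z j)
          (Func.cong (g.fun j) (f.natural c x)) (g.natural c (f.to x))
    }
    where
      module f = Homomorphism f
      module g = Homomorphism g

  module _ {a e a′ e′} {X : Algebra a e} {Y : Algebra a′ e′} (f : Homomorphism X Y) where
    ComponentwiseInjective : Set (ℓ ⊔ a ⊔ e ⊔ e′)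
    ComponentwiseInjective =
      ∀ i → Injective (Algebra.Eq X i) (Algebra.Eq Y i) (Homomorphism.to f)

    ComponentwiseSurjective : Set (ℓ ⊔ a ⊔ e ⊔ a′ ⊔ e′)
    ComponentwiseSurjective =
      ∀ i → Surjective (Algebra.Eq X i) (Algebra.Eq Y i) (Homomorphism.to f)

  data ∫-Eq {a e} (X : Algebra a e) :
            ∃ (Algebra.⟨_⟩ X) → ∃ (Algebra.⟨_⟩ X) → Set (ℓ ⊔ a ⊔ e) where
    at : ∀ {k x y} → Algebra.Eq X k x y → ∫-Eq X (k , x) (k , y)

  ∫ : ∀ {a e} → Algebra a e → Setoid (ℓ ⊔ a) (ℓ ⊔ a ⊔ e)
  ∫ X = record
    { Carrier = ∃ (Algebra.⟨_⟩ X)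
    ; _≈_ = ∫-Eq X
    ; isEquivalence = record
      { refl  = λ { {k , _} → at (Setoid.refl (Algebra.carrier X k)) }
      ; sym   = λ { {k , _} (at p) → at (Setoid.sym (Algebra.carrier X k) p) }
      ; trans = λ { {k , _} (at p) (at q) → at (Setoid.trans (Algebra.carrier X k) p q) }
      }
    }

-- From here on, sets live in `Set ℓ`, and subsets are predicates valued in
-- `Set ℓ`.  The collection of all countable subsets of a type in `Set ℓ` is then
-- a type in `Set (lsuc ℓ)`, so 𝐇 and 𝐒 send Algebra ℓ ℓ to Algebra (lsuc ℓ) ℓ.
module Coalgebras {ℓ} (C : Category ℓ) (C-countable : Category.Arrow C ↣ ℕ) (O : Set ℓ) where
  open Category C
  open Algebras C public

  arrowCode : ∀ {i j} → Hom i j → ℕ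
  arrowCode {i} {j} c = Injection.to C-countable (i , j , c)

  module _ (X : Algebra ℓ ℓ) where
    private module X = Algebra X

    Triples : Obj → Setoid ℓ ℓ
    Triples i = ≡-setoid (∃ λ j → Hom i j) ×ₛ (≡-setoid O ×ₛ ∫ X)

    Triple : Obj → Set ℓ
    Triple i = Setoid.Carrier (Triples i)

    record 𝐆 (i : Obj) : Set (lsuc ℓ) where
      field
        subset    : Pred (Triple i) ℓ
        resp      : subset Respects Setoid._≈_ (Triples i)
        countable : Countable (Triples i) subset

    open 𝐆

    -- {(c₂,o,x) ∣ (c₁,o,x) ∈ A, c₁ = d;c₂}
    residual : ∀ {i k} → Hom i k → Pred (Triple i) ℓ → Pred (Triple k) ℓ
    residual d A ((j , c₂) , o , x) = ((j , d ⨾ c₂) , o , x) ∈ A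

    𝐆-residual : ∀ {i k} → Hom i k → 𝐆 i → 𝐆 k
    𝐆-residual {i} {k} d A = record
      { subset    = residual d (subset A)
      ; resp      = λ { (refl , o≡ , x≈) → resp A (refl , o≡ , x≈) }
      ; countable = record
        { code           = λ {t} p → pair (code p) (arrowCode (proj₂ (proj₁ t)))
        ; code-injective = λ p q eq → inj p q (pair-injective _ _ _ _ eq)
        }
      }
      where
        open Countable (countable A)
        inj : ∀ {j c o x j′ c′ o′ x′}
              (p : subset A ((j , d ⨾ c) , o , x)) (q : subset A ((j′ , d ⨾ c′) , o′ , x′)) →
              code p ≡ code q × arrowCode c ≡ arrowCode c′ →
              Setoid._≈_ (Triples k) ((j , c) , o , x) ((j′ , c′) , o′ , x′)
        inj p q (m≡ , n≡) with refl ← Injection.injective C-countable n≡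
          = refl , proj₂ (code-injective p q m≡)

    𝐆-setoid : Obj → Setoid (lsuc ℓ) ℓ
    𝐆-setoid i = record
      { Carrier = 𝐆 i
      ; _≈_ = λ A B → subset A ≐ subset B
      ; isEquivalence = record { refl = ≐-refl ; sym = ≐-sym ; trans = ≐-trans }
      }

    𝐇 : Algebra (lsuc ℓ) ℓ
    𝐇 = record
      { carrier = 𝐆-setoid
      ; action  = λ d → record { to = 𝐆-residual d ; cong = λ (A⊆B , B⊆A) → A⊆B , B⊆A }
      ; act-id  = λ A → (λ {t} → move A (idˡ (proj₂ (proj₁ t))))
                      , (λ {t} → move A (sym (idˡ (proj₂ (proj₁ t)))))
      ; act-⨾   = λ d e A → (λ {t} → move A (assoc d e (proj₂ (proj₁ t))))
                          , (λ {t} → move A (sym (assoc d e (proj₂ (proj₁ t)))))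
      }
      where
        move : ∀ {i j o x} {c c′ : Hom i j} (A : 𝐆 i) → c ≡ c′ →
               ((j , c) , o , x) ∈ subset A → ((j , c′) , o , x) ∈ subset A
        move A refl p = p

  open 𝐆 public

  module _ {X Y : Algebra ℓ ℓ} (h : Homomorphism X Y) where
    private
      module X = Algebra X
      module Y = Algebra Y
      open Homomorphism h using (to; fun; natural)

    mapTriple : ∀ {i} → Triple X i → Triple Y i
    mapTriple ((j , c) , o , (k , x)) = (j , c) , o , (k , to x)

    mapTriple-cong : ∀ {i} {t t′ : Triple X i} → Setoid._≈_ (Triples X i) t t′ →
                     Setoid._≈_ (Triples Y i) (mapTriple t) (mapTriple t′)
    mapTriple-cong (refl , refl , at {k} x≈) = refl , refl , at (Func.cong (fun k) x≈)

    -- {(c,o,h(x)) ∣ (c,o,x) ∈ A}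
    image : ∀ {i} → Pred (Triple X i) ℓ → Pred (Triple Y i) ℓ
    image {i} A t = ∃ λ s → s ∈ A × Setoid._≈_ (Triples Y i) (mapTriple s) t

    𝐆-image : ∀ {i} → 𝐆 X i → 𝐆 Y i
    𝐆-image {i} A = record
      { subset    = image (subset A)
      ; resp      = λ t≈t′ (s , s∈A , hs≈t) → s , s∈A , T.trans hs≈t t≈t′
      ; countable = record
        { code           = λ (s , s∈A , _) → code s∈A
        ; code-injective = λ (s , s∈A , hs≈t) (s′ , s′∈A , hs′≈t′) eq →
            T.trans (T.sym hs≈t)
              (T.trans (mapTriple-cong (code-injective s∈A s′∈A eq)) hs′≈t′)
        }
      }
      where
        module T = Setoid (Triples Y i)
        open Countable (countable A)

    𝐇-map : Homomorphism (𝐇 X) (𝐇 Y)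
    𝐇-map = record
      { fun     = λ i → record
        { to   = 𝐆-image
        ; cong = λ (A⊆B , B⊆A) → (λ (s , p , eq) → s , A⊆B p , eq)
                               , (λ (s , p , eq) → s , B⊆A p , eq)
        }
      ; natural = λ d A →
          (λ { (((j , c) , o , x) , p , (refl , eq)) → ((j , d ⨾ c) , o , x) , p , (refl , eq) })
        , (λ { {(j , c) , _} (((_ , _) , o , x) , p , (refl , eq)) →
               ((j , c) , o , x) , p , (refl , eq) })
      }

  record Coalgebra : Set (lsuc ℓ) where
    field
      algebra   : Algebra ℓ ℓ
      structure : Homomorphism algebra (𝐇 algebra)

  open Coalgebra

  record CoalgebraMorphism (A B : Coalgebra) : Set ℓ where
    field
      hom      : Homomorphism (algebra A) (algebra B)
      commutes : structure A ⨟ 𝐇-map hom ≋ hom ⨟ structure B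

  open CoalgebraMorphism

  _IsSubcoalgebraOf_ : Coalgebra → Coalgebra → Set ℓ
  A IsSubcoalgebraOf B = Σ (CoalgebraMorphism A B) λ m → ComponentwiseInjective (hom m)

  -- A homomorphic image is determined only up to isomorphism, by an arbitrary
  -- choice of factorization, so being one is a property of the coalgebra I.
  record IsHomomorphicImage {A B : Coalgebra} (h : CoalgebraMorphism A B) (I : Coalgebra) : Set ℓ where
    field
      e          : CoalgebraMorphism A I
      m          : CoalgebraMorphism I B
      surjective : ComponentwiseSurjective (hom e)
      injective  : ComponentwiseInjective (hom m)
      factors    : hom h ≋ hom e ⨟ hom m

  record IsCoproduct {J : Set ℓ} (F : J → Coalgebra) (S : Coalgebra) : Set (lsuc ℓ) where
    field
      inject        : ∀ j → CoalgebraMorphism (F j) S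
      copair        : ∀ {Z} → (∀ j → CoalgebraMorphism (F j) Z) → CoalgebraMorphism S Z
      inject-copair : ∀ {Z} (f : ∀ j → CoalgebraMorphism (F j) Z) j →
                      hom (inject j) ⨟ hom (copair f) ≋ hom (f j)
      unique        : ∀ {Z} (f : ∀ j → CoalgebraMorphism (F j) Z) (u : CoalgebraMorphism S Z) →
                      (∀ j → hom (inject j) ⨟ hom u ≋ hom (f j)) → hom u ≋ hom (copair f)

  record IsCovariety {p} (P : Pred Coalgebra p) : Set (lsuc ℓ ⊔ p) where
    field
      subcoalgebras     : ∀ {A B} → A IsSubcoalgebraOf B → B ∈ P → A ∈ P
      homomorphicImages : ∀ {A B} (h : CoalgebraMorphism A B) {I} →
                          IsHomomorphicImage h I → A ∈ P → I ∈ P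
      sums              : ∀ {J : Set ℓ} (F : J → Coalgebra) {S} →
                          IsCoproduct F S → (∀ j → F j ∈ P) → S ∈ P

  -- The rule c –[o / o′]→ d belongs to T iff T c o o′ d is inhabited.
  InferenceSystem : Set (lsuc ℓ)
  InferenceSystem = ∀ {i i′ j j′} → Hom i i′ → O → O → Hom j j′ → Set ℓ

  data Φ (T : InferenceSystem) : InferenceSystem where
    rule     : ∀ {i i′ j j′} {c : Hom i i′} {d : Hom j j′} {o o′} → T c o o′ d → Φ T c o o′ d
    identity : ∀ {i j o} → Φ T (id {i}) o o (id {j})
    compose  : ∀ {i i′ i″ j j′ j″ o o′ o″}
               {c : Hom i i′} {d : Hom i′ i″} {c′ : Hom j j′} {d′ : Hom j′ j″} →
               Φ T c o o′ c′ → Φ T d o′ o″ d′ → Φ T (c ⨾ d) o o″ (c′ ⨾ d′)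

  module Saturation (T : InferenceSystem) (X : Algebra ℓ ℓ) where
    private module X = Algebra X

    -- t₁ ⊢[ d ] t₂ is t₁ ⊢ᵈ t₂.  The equations on e and e′ fix their sources and
    -- targets, so those are built into the types.
    infix 4 _⊢[_]_
    _⊢[_]_ : ∀ {i k} → Triple X i → Hom i k → Triple X k → Set ℓ
    ((j₁ , c₁) , o₁ , (k₁ , q₁)) ⊢[ d ] ((j₂ , c₂) , o₂ , (k₂ , q₂)) =
      Σ (Hom j₁ j₂) λ e → Σ (Hom k₁ k₂) λ e′ →
        c₁ ⨾ e ≡ d ⨾ c₂ × Φ T e o₁ o₂ e′ × X.Eq k₂ (X.act e′ q₁) q₂

    Saturated : ∀ {i} → Pred (𝐆 X i) ℓ
    Saturated A = ∀ {t₁ t₂} → t₁ ∈ subset A → t₁ ⊢[ id ] t₂ → t₂ ∈ subset A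

    𝐒-setoid : Obj → Setoid (lsuc ℓ) ℓ
    𝐒-setoid i = record
      { Carrier = Σ (𝐆 X i) Saturated
      ; _≈_ = λ (A , _) (B , _) → subset A ≐ subset B
      ; isEquivalence = record { refl = ≐-refl ; sym = ≐-sym ; trans = ≐-trans }
      }

    -- {t₂ ∣ ∃ t₁ ∈ A, t₁ ⊢ᵈ t₂}
    derivable : ∀ {i k} → Hom i k → Pred (Triple X i) ℓ → Pred (Triple X k) ℓ
    derivable d A t₂ = ∃ λ t₁ → t₁ ∈ A × t₁ ⊢[ d ] t₂

    module _ {i k} (d : Hom i k) where

      derivable⊆residual : ∀ (A : 𝐆 X i) → Saturated A →
        ∀ t → t ∈ derivable d (subset A) → t ∈ residual X d (subset A)
      derivable⊆residual A sat _ (t₁ , t₁∈A , e , e′ , eq , φ , q≈) =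
        sat t₁∈A (e , e′ , trans eq (sym (idˡ _)) , φ , q≈)

      residual⊆derivable : ∀ (A : 𝐆 X i) →
        ∀ t → t ∈ residual X d (subset A) → t ∈ derivable d (subset A)
      residual⊆derivable A ((j , c) , o , (_ , q)) p =
        ((j , d ⨾ c) , o , (_ , q)) , p , id , id , idʳ _ , identity , X.act-id q

      ⊢-resp : ∀ {t₁ : Triple X i} → (t₁ ⊢[ d ]_) Respects Setoid._≈_ (Triples X k)
      ⊢-resp (refl , refl , at {k₂} x≈) (e , e′ , eq , φ , q≈) =
        e , e′ , eq , φ , Setoid.trans (X.carrier k₂) q≈ x≈

      -- d ⨾ c₂ labels an element of A whenever t₂ = (c₂ , …) is derivable, so a
      -- code for that element and one for c₂ together determine t₂.
      𝐒-act : Σ (𝐆 X i) Saturated → Σ (𝐆 X k) Saturated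
      𝐒-act (A , sat) = B , sat′
        where
          open Countable (countable (𝐆-residual X d A))
          B : 𝐆 X k
          B = record
            { subset    = derivable d (subset A)
            ; resp      = λ t≈ (t₁ , t₁∈A , der) → t₁ , t₁∈A , ⊢-resp t≈ der
            ; countable = record
              { code           = λ {t} p → code {t} (derivable⊆residual A sat t p)
              ; code-injective = λ {t} {t′} p q →
                  code-injective (derivable⊆residual A sat t p) (derivable⊆residual A sat t′ q)
              }
            }
          sat′ : Saturated B
          sat′ {t₁} {t₂} p (e , e′ , eq , φ , q≈) =
            residual⊆derivable A t₂
              (sat (derivable⊆residual A sat t₁ p)
                (e , e′ , trans (assoc d _ e) (trans (cong (d ⨾_) (trans eq (idˡ _))) (sym (idˡ _)))
                , φ , q≈))

      𝐒-act≐residual : ∀ ((A , sat) : Σ (𝐆 X i) Saturated) →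
        subset (proj₁ (𝐒-act (A , sat))) ≐ residual X d (subset A)
      𝐒-act≐residual (A , sat) =
        (λ {t} → derivable⊆residual A sat t) , (λ {t} → residual⊆derivable A t)

    𝐒 : Algebra (lsuc ℓ) ℓ
    𝐒 = record
      { carrier = 𝐒-setoid
      ; action  = λ d → record
        { to   = 𝐒-act d
        ; cong = λ (A⊆B , B⊆A) → (λ (t , p , der) → t , A⊆B p , der)
                               , (λ (t , p , der) → t , B⊆A p , der)
        }
      ; act-id  = λ A → ≐-trans (𝐒-act≐residual id A) (Algebra.act-id (𝐇 X) (proj₁ A))
      ; act-⨾   = λ d e A →
          ≐-trans (𝐒-act≐residual (d ⨾ e) A)
          (≐-trans (Algebra.act-⨾ (𝐇 X) d e (proj₁ A))
          (≐-trans (Func.cong (Algebra.action (𝐇 X) e)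
                      {𝐆-residual X d (proj₁ A)} {proj₁ (𝐒-act d A)}
                      (≐-sym (𝐒-act≐residual d A)))
                   (≐-sym (𝐒-act≐residual e (𝐒-act d A)))))
      }

    ι : Homomorphism 𝐒 (𝐇 X)
    ι = record
      { fun     = λ i → record { to = proj₁ ; cong = λ A≐B → A≐B }
      ; natural = 𝐒-act≐residual
      }

  -- The objects of Coalg_{𝐇ᴵ}.  It is a full subcategory, so its objects are all
  -- there is to specify.
  Coalg-𝐇ᴵ : InferenceSystem → Pred Coalgebra (lsuc ℓ)
  Coalg-𝐇ᴵ T A = Σ (Homomorphism (algebra A) (𝐒 T (algebra A))) λ α′ →
                   structure A ≋ α′ ⨟ ι T (algebra A)
    where open Saturation

{-# OPTIONS --safe #-}

-- A coalgebra lies in Coalg_{𝐇ᴵ} iff all its sets α(x) are saturated: naturality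
-- of α′ is automatic, because 𝐒 acts as 𝐇 on saturated sets.  Every derivation
-- h(s) ⊢ t lifts along a homomorphism h to a derivation from s, so images of
-- saturated sets are saturated; if h is injective, then A is saturated as soon as
-- h(A) is.  This gives closure under images and subcoalgebras.  An abstract
-- coproduct embeds into the disjoint union of its summands, where all sets α(x)
-- are images of saturated ones.
module Submission where

open import Defs
open import Data.Nat using (ℕ)
open import Data.Product using (∃; _×_; _,_; proj₁; proj₂)
open import Function.Base using (_∘_)
open import Function.Bundles using (Func; _↣_)
open import Function.Construct.Identity using (function)
open import Relation.Binary.Bundles using (Setoid)
open import Relation.Binary.PropositionalEquality using (refl)
open import Relation.Unary using (Pred; _∈_; _≐_)
open import Relation.Unary.Properties using (≐-refl; ≐-sym; ≐-trans)

-- Identity homomorphisms and disjoint unions of algebras.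

module AlgebraProperties {ℓ} (C : Category ℓ) where
  open Algebras C

  idHom : ∀ {a e} {X : Algebra a e} → Homomorphism X X
  idHom {X = X} = record
    { fun     = λ i → function (Algebra.carrier X i)
    ; natural = λ {_} {j} c x → Setoid.refl (Algebra.carrier X j)
    }

  module _ {J : Set ℓ} (X : J → Algebra ℓ ℓ) where
    private module X j = Algebra (X j)

    -- An inductive family rather than a pair of equations: matching on `at` unifies the two summand
    -- indices, so no transport along an equality in `J` is needed.
    data ∐-Eq i : ∃ (λ j → X.⟨_⟩ j i) → ∃ (λ j → X.⟨_⟩ j i) → Set ℓ where
      at : ∀ {j x y} → X.Eq j i x y → ∐-Eq i (j , x) (j , y)

    ∐ : Algebra ℓ ℓ
    ∐ = record
      { carrier = λ i → record
        { Carrier = ∃ λ j → X.⟨_⟩ j i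
        ; _≈_ = ∐-Eq i
        ; isEquivalence = record
          { refl  = λ { {j , _} → at (Setoid.refl (X.carrier j i)) }
          ; sym   = λ { {j , _} (at p) → at (Setoid.sym (X.carrier j i) p) }
          ; trans = λ { {j , _} (at p) (at q) → at (Setoid.trans (X.carrier j i) p q) }
          }
        }
      ; action = λ c → record
        { to   = λ (j , x) → j , X.act j c x
        ; cong = λ { {j , _} (at p) → at (Func.cong (X.action j c) p) }
        }
      ; act-id = λ (j , x) → at (X.act-id j x)
      ; act-⨾  = λ d e (j , x) → at (X.act-⨾ j d e x)
      }

    ∐-inject : ∀ j → Homomorphism (X j) ∐
    ∐-inject j = record
      { fun     = λ i → record { to = j ,_ ; cong = at }
      ; natural = λ {_} {k} c x → at (Setoid.refl (X.carrier j k))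
      }

    ∐-copair : ∀ {a e} {Y : Algebra a e} → (∀ j → Homomorphism (X j) Y) → Homomorphism ∐ Y
    ∐-copair f = record
      { fun     = λ i → record
        { to   = λ (j , x) → Homomorphism.to (f j) x
        ; cong = λ { {j , _} (at p) → Func.cong (Homomorphism.fun (f j) i) p }
        }
      ; natural = λ c (j , x) → Homomorphism.natural (f j) c x
      }

-- Identities, composition and explicit sums of coalgebras.

module CoalgebraProperties {ℓ} (C : Category ℓ) (C-countable : Category.Arrow C ↣ ℕ) (O : Set ℓ) where
  open Category C
  open Coalgebras C C-countable O
  open AlgebraProperties C
  open Coalgebra
  open CoalgebraMorphism

  -- `image` closes its result under setoid equality, so one inclusion is exactly `resp A`; this is
  -- why `A` is a `𝐆` and not a bare predicate.
  image-id : ∀ {X : Algebra ℓ ℓ} {i} (A : 𝐆 X i) → image (idHom {X = X}) (subset A) ≐ subset A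
  image-id {X} A = (λ (s , s∈A , s≈t) → resp A s≈t s∈A)
                 , (λ {t} t∈A → t , t∈A , Setoid.refl (Triples X _) {t})

  image-⨟ : ∀ {X Y Z : Algebra ℓ ℓ} (f : Homomorphism X Y) (g : Homomorphism Y Z)
            {i} (A : Pred (Triple X i) ℓ) → image (f ⨟ g) A ≐ image g (image f A)
  image-⨟ {X} {Y} {Z} f g A =
      (λ (s , s∈A , eq) →
         mapTriple f s , (s , s∈A , Setoid.refl (Triples Y _) {mapTriple f s}) , eq)
    , (λ (_ , (s , s∈A , fs≈r) , gr≈t) →
         s , s∈A , Setoid.trans (Triples Z _) (mapTriple-cong g fs≈r) gr≈t)

  idMorphism : ∀ {A} → CoalgebraMorphism A A
  idMorphism {A} = record
    { hom      = idHom
    ; commutes = λ i x → image-id (Homomorphism.to (structure A) x)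
    }

  infixr 9 _⨟ᶜ_
  _⨟ᶜ_ : ∀ {A B D} → CoalgebraMorphism A B → CoalgebraMorphism B D → CoalgebraMorphism A D
  _⨟ᶜ_ {A} {B} f g = record
    { hom      = hom f ⨟ hom g
    ; commutes = λ i x →
        ≐-trans (image-⨟ (hom f) (hom g) (subset (Homomorphism.to (structure A) x)))
        (≐-trans (Func.cong (Homomorphism.fun (𝐇-map (hom g)) i)
                   {𝐆-image (hom f) (Homomorphism.to (structure A) x)}
                   {Homomorphism.to (structure B) (Homomorphism.to (hom f) x)}
                   (commutes f i x))
                 (commutes g i (Homomorphism.to (hom f) x)))
    }

  module _ {J : Set ℓ} (F : J → Coalgebra) where
    private ∐F = ∐ (algebra ∘ F)

    ∐ᶜ : Coalgebra
    ∐ᶜ = record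
      { algebra   = ∐F
      ; structure = ∐-copair _ λ j → structure (F j) ⨟ 𝐇-map (∐-inject (algebra ∘ F) j)
      }

    ∐ᶜ-inject : ∀ j → CoalgebraMorphism (F j) ∐ᶜ
    ∐ᶜ-inject j = record
      { hom      = ∐-inject (algebra ∘ F) j
      ; commutes = λ i x → ≐-refl
      }

    ∐ᶜ-copair : ∀ {Z} → (∀ j → CoalgebraMorphism (F j) Z) → CoalgebraMorphism ∐ᶜ Z
    ∐ᶜ-copair f = record
      { hom      = ∐-copair _ (hom ∘ f)
      ; commutes = λ i (j , x) →
          -- Once the two images are merged, injection followed by copairing computes to
          -- `hom (f j)`, which leaves the square of `f j`.
          ≐-trans (≐-sym (image-⨟ (∐-inject (algebra ∘ F) j) (∐-copair _ (hom ∘ f))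
                            (subset (Homomorphism.to (structure (F j)) x))))
                  (commutes (f j) i x)
      }

    -- Mapping S to ∐ᶜ F and back is the identity, by uniqueness of copairings.
    coproduct-subcoalgebra : ∀ {S} → IsCoproduct F S → S IsSubcoalgebraOf ∐ᶜ
    coproduct-subcoalgebra {S} isCoproduct = to∐ , λ i {x} {y} eq →
        S.trans i (S.sym i (retract i x))
          (S.trans i (Func.cong (Homomorphism.fun (hom from∐) i) eq) (retract i y))
      where
        open IsCoproduct isCoproduct
        module S i = Setoid (Algebra.carrier (algebra S) i)

        to∐ : CoalgebraMorphism S ∐ᶜ
        to∐ = copair ∐ᶜ-inject

        from∐ : CoalgebraMorphism ∐ᶜ S
        from∐ = ∐ᶜ-copair inject

        retract : hom to∐ ⨟ hom from∐ ≋ idHom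
        retract i x = S.trans i
          (unique inject (to∐ ⨟ᶜ from∐)
            (λ j k y → Func.cong (Homomorphism.fun (hom from∐) k) (inject-copair ∐ᶜ-inject j k y))
            i x)
          (S.sym i (unique inject idMorphism (λ j k y → S.refl k) i x))

  -- Saturated sets under homomorphisms.

  module _ (T : InferenceSystem) where
    open Saturation T

    Saturated-resp : ∀ {X : Algebra ℓ ℓ} {i} {A B : 𝐆 X i} →
                     subset A ≐ subset B → Saturated X A → Saturated X B
    Saturated-resp (A⊆B , B⊆A) sat t₁∈B t₁⊢t₂ = A⊆B (sat (B⊆A t₁∈B) t₁⊢t₂)

    module _ {X Y : Algebra ℓ ℓ} (h : Homomorphism X Y) where
      private
        module X = Algebra X
        module Y = Algebra Y
        module h = Homomorphism h

      -- `Φ T` does not mention the algebra, so the same `e` and `e′` serve in `Y`; only the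
      -- equation between states is transported, by naturality of `h` at `e′`.
      mapTriple-⊢ : ∀ {i k} {d : Hom i k} {t₁ : Triple X i} {t₂ : Triple X k} →
                    _⊢[_]_ X t₁ d t₂ → _⊢[_]_ Y (mapTriple h t₁) d (mapTriple h t₂)
      mapTriple-⊢ {t₁ = _ , _ , _ , q₁} {_ , _ , k₂ , _} (e , e′ , eq , φ , q≈) =
        e , e′ , eq , φ ,
        Setoid.trans (Y.carrier k₂) (Setoid.sym (Y.carrier k₂) (h.natural e′ q₁))
          (Func.cong (h.fun k₂) q≈)

      -- A derivation acts on the state by applying `e′`. Applying `e′` to the state of `s₁` instead
      -- gives `s₂`, with label and observation copied from `t₂`; naturality shows that `h` sends it
      -- to `t₂`.
      ⊢-lift : ∀ {i k} {d : Hom i k} {s₁ : Triple X i} {t₁ : Triple Y i} {t₂ : Triple Y k} →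
               Setoid._≈_ (Triples Y i) (mapTriple h s₁) t₁ → _⊢[_]_ Y t₁ d t₂ →
               ∃ λ s₂ → _⊢[_]_ X s₁ d s₂ × Setoid._≈_ (Triples Y k) (mapTriple h s₂) t₂
      ⊢-lift {s₁ = _ , _ , _ , p₁} {t₂ = (j₂ , c₂) , o₂ , k₂ , _}
             (refl , refl , at hp≈q) (e , e′ , eq , φ , q≈) =
        ((j₂ , c₂) , o₂ , k₂ , X.act e′ p₁) ,
        (e , e′ , eq , φ , Setoid.refl (X.carrier k₂)) ,
        (refl , refl , at (Setoid.trans (Y.carrier k₂) (h.natural e′ p₁)
                            (Setoid.trans (Y.carrier k₂) (Func.cong (Y.action e′) hp≈q) q≈)))

      image-saturated : ∀ {i} (A : 𝐆 X i) → Saturated X A → Saturated Y (𝐆-image h A)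
      image-saturated A sat {t₁} {t₂} (s₁ , s₁∈A , hs₁≈t₁) t₁⊢t₂
        with s₂ , s₁⊢s₂ , hs₂≈t₂ ← ⊢-lift {s₁ = s₁} {t₁} {t₂} hs₁≈t₁ t₁⊢t₂
        = s₂ , sat s₁∈A s₁⊢s₂ , hs₂≈t₂

      mapTriple-injective : ComponentwiseInjective h → ∀ {i} {s t : Triple X i} →
        Setoid._≈_ (Triples Y i) (mapTriple h s) (mapTriple h t) → Setoid._≈_ (Triples X i) s t
      mapTriple-injective inj {t = _ , _ , k , _} (refl , refl , at eq) =
        refl , refl , at (inj k eq)

      -- Pushing the derivation forward puts `mapTriple h t₂` into the image of `A`. This only
      -- yields some `s` in `A` with the same value under `h`; injectivity identifies `s` with `t₂`.
      saturated-of-image : ComponentwiseInjective h → ∀ {i} (A : 𝐆 X i) →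
                           Saturated Y (𝐆-image h A) → Saturated X A
      saturated-of-image inj A sat {t₁} {t₂} t₁∈A t₁⊢t₂
        with s , s∈A , hs≈ht₂ ← sat (t₁ , t₁∈A , Setoid.refl (Triples Y _) {mapTriple h t₁})
                                    (mapTriple-⊢ {t₁ = t₁} {t₂} t₁⊢t₂)
        = resp A (mapTriple-injective inj {s = s} {t₂} hs≈ht₂) s∈A

    -- Coalgebras whose structure takes only saturated values, and their closure properties.

    AllSaturated : Pred Coalgebra ℓ
    AllSaturated A = ∀ i (x : Algebra.⟨_⟩ (algebra A) i) →
                     Saturated (algebra A) (Homomorphism.to (structure A) x)

    Coalg-𝐇ᴵ⇒AllSaturated : ∀ A → A ∈ Coalg-𝐇ᴵ T → A ∈ AllSaturated
    Coalg-𝐇ᴵ⇒AllSaturated A (α′ , α≋α′) i x =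
      Saturated-resp {A = proj₁ (Homomorphism.to α′ x)} {B = Homomorphism.to (structure A) x}
        (≐-sym (α≋α′ i x)) (proj₂ (Homomorphism.to α′ x))

    AllSaturated⇒Coalg-𝐇ᴵ : ∀ A → A ∈ AllSaturated → A ∈ Coalg-𝐇ᴵ T
    AllSaturated⇒Coalg-𝐇ᴵ A sat = record
      { fun     = λ i → record
        { to   = λ x → Homomorphism.to (structure A) x , sat i x
        -- Equality in `𝐒` compares underlying subsets and ignores saturation proofs, so the
        -- congruence of the structure map carries over unchanged.
        ; cong = Func.cong (Homomorphism.fun (structure A) i)
        }
      ; natural = λ {i} c x →
          ≐-trans (Homomorphism.natural (structure A) c x)
            (≐-sym (𝐒-act≐residual (algebra A) c (Homomorphism.to (structure A) x , sat i x)))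
      } , λ i x → ≐-refl

    -- The morphism square says that the value of `B` at `m(x)` is the image under `m` of the value
    -- of `A` at `x`, so saturation can be reflected along the injective `m`.
    sub-saturated : ∀ {A B} → A IsSubcoalgebraOf B → B ∈ AllSaturated → A ∈ AllSaturated
    sub-saturated {A} {B} (m , inj) sat i x =
      saturated-of-image (hom m) inj (Homomorphism.to (structure A) x)
        (Saturated-resp {A = Homomorphism.to (structure B) (Homomorphism.to (hom m) x)}
          {B = 𝐆-image (hom m) (Homomorphism.to (structure A) x)}
          (≐-sym (commutes m i x)) (sat i (Homomorphism.to (hom m) x)))

    -- Each `y` equals some `e(x)`, so its value is the image of a saturated set. For a homomorphic
    -- image, `e` is the surjective factor.
    quotient-saturated : ∀ {A B} (e : CoalgebraMorphism A B) → ComponentwiseSurjective (hom e) →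
                         A ∈ AllSaturated → B ∈ AllSaturated
    quotient-saturated {A} {B} e surj sat i y
      with x , ex≈y ← surj i y
      = Saturated-resp {A = 𝐆-image (hom e) (Homomorphism.to (structure A) x)}
          {B = Homomorphism.to (structure B) y}
          (≐-trans (commutes e i x)
            (Func.cong (Homomorphism.fun (structure B) i)
              -- `Surjective` sends everything equal to `x` to `y`; reflexivity picks `x` itself.
              (ex≈y (Setoid.refl (Algebra.carrier (algebra A) i)))))
          (image-saturated (hom e) (Homomorphism.to (structure A) x) (sat i x))

    ∐ᶜ-saturated : ∀ {J : Set ℓ} (F : J → Coalgebra) →
                   (∀ j → F j ∈ AllSaturated) → ∐ᶜ F ∈ AllSaturated
    ∐ᶜ-saturated F sat i (j , x) =
      image-saturated (∐-inject (algebra ∘ F) j) (Homomorphism.to (structure (F j)) x) (sat j i x)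

proposition7p7 : ∀ {ℓ} (C : Category ℓ) (C-countable : Category.Arrow C ↣ ℕ) (O : Set ℓ)
    (T : Coalgebras.InferenceSystem C C-countable O) →
    Coalgebras.IsCovariety C C-countable O (Coalgebras.Coalg-𝐇ᴵ C C-countable O T)
proposition7p7 C C-countable O T = record
  { subcoalgebras     = λ {A} {B} A⊆B B∈P →
      AllSaturated⇒Coalg-𝐇ᴵ T A (sub-saturated T A⊆B (Coalg-𝐇ᴵ⇒AllSaturated T B B∈P))
  ; homomorphicImages = λ {A} h {I} image A∈P →
      AllSaturated⇒Coalg-𝐇ᴵ T I
        (quotient-saturated T (IsHomomorphicImage.e image) (IsHomomorphicImage.surjective image)
          (Coalg-𝐇ᴵ⇒AllSaturated T A A∈P))
  ; sums              = λ F {S} isCoproduct F∈P →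
      AllSaturated⇒Coalg-𝐇ᴵ T S
        (sub-saturated T (coproduct-subcoalgebra F isCoproduct)
          (∐ᶜ-saturated T F (λ j → Coalg-𝐇ᴵ⇒AllSaturated T (F j) (F∈P j))))
  }
  where
    open Coalgebras C C-countable O
    open CoalgebraProperties C C-countable O
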